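{- For every formula $\varphi\in\mathcal L^{\mathsf{K}^*}$, $\varphi$ is valid on all $\mathsf{K}^*$-models if and only if $\iota(\varphi)$ is valid on all $\mathsf{CK}$-models.
   Context: Relations. $(R;S)$ is composition: $x(R;S)y$ iff there is $z$ with $xRz$ and $zSy$. $R^*$ is the reflexive-transitive closure of $R$. $\mathrm{Prop}$ is a set of proposition symbols. Classical logic $\mathsf{K}^*$. $\mathcal L^{\mathsf{K}^*}$ is given by $\varphi::=p\mid\neg\varphi\mid\varphi\wedge\varphi\mid\varphi\vee\varphi\mid\Box\varphi\mid\Box^*\varphi$, with $p\in\mathrm{Prop}$ (diamonds are abbreviations, to be expanded). A $\mathsf{K}^*$-model is $(W,R,\|\cdot\|)$ with $R\subseteq W\times W$ and $\|\cdot\|:\mathrm{Prop}\to\mathcal P(W)$; Boolean connectives are classical, $\Box$ is the standard modality for $R$, and $\Box^*$ the standard modality for $R^*$. Constructive semantics. $\mathcal L^*_\Box$ is given by $\varphi ::= \bot \mid p\mid \varphi\land\varphi \mid \varphi\lor\varphi \mid \varphi\to\varphi \mid \Box\varphi \mid \Box^*\varphi$, with $\neg\varphi:=\varphi\to\bot$; formulas of $\mathcal L^{\mathsf{K}^*}$ are read as formulas of $\mathcal L^*_\Box$ by reading $\neg\varphi$ as $\varphi\to\bot$. A $\mathsf{CK}$-model is $\mathcal M=(W,\preccurlyeq,R,\|\cdot\|)$ where $\preccurlyeq$ is a preorder on $W$, $R$ is any binary relation on $W$, and $\|\cdot\|:\mathrm{Prop}\cup\{\bot\}\to\mathcal P(W)$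 is such that for all $p\in\mathrm{Prop}$: (1) $\|\bot\|\subseteq\|p\|$; (2) if $w\preccurlyeq v$ and $w\in\|p\|$ then $v\in\|p\|$; (3) if $w\in\|\bot\|$ and ($w\preccurlyeq v$ or $wRv$) then $v\in\|\bot\|$; (4) if $w\in\|\bot\|$ then there is $v$ with $wRv$. Satisfaction: $(\mathcal M,w)\Vdash\bot$ iff $w\in\|\bot\|$; $(\mathcal M,w)\Vdash p$ iff $w\in\|p\|$; $\wedge,\vee$ pointwise as usual; $(\mathcal M,w)\Vdash\varphi\to\psi$ iff for all $v\succcurlyeq w$, $(\mathcal M,v)\Vdash\varphi$ implies $(\mathcal M,v)\Vdash\psi$; $(\mathcal M,w)\Vdash\Box\varphi$ iff $(\mathcal M,v)\Vdash\varphi$ for all $v$ with $w(\preccurlyeq;R)v$; $(\mathcal M,w)\Vdash\Box^*\varphi$ iff $(\mathcal M,v)\Vdash\varphi$ for all $v$ with $w(\preccurlyeq;R)^*v$. Validity on a model means satisfaction at all its worlds. Translation. For $\varphi\in\mathcal L^{\mathsf{K}^*}$ with set of subformulas $Subf(\varphi)$, $\iota(\varphi):=\Box^*\bigwedge\{\psi\vee\neg\psi\mid\psi\in Subf(\varphi)\}\to\varphi$, an $\mathcal L^*_\Box$-formula. -}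

module Defs where

open import Level using (Level; _⊔_; suc)
open import Data.List.NonEmpty using (List⁺; _∷_; toList; map; foldr₁)
open import Data.List.Base using ([]; _++_)
open import Data.Product.Base using (_×_; ∃)
open import Data.Sum.Base using (_⊎_)
open import Relation.Nullary.Negation.Core using () renaming (¬_ to Not_)
open import Relation.Unary using (Pred; _∈_; _⊆_)
open import Relation.Binary.Core using (Rel)
open import Relation.Binary.Structures using (IsPreorder)
open import Relation.Binary.PropositionalEquality.Core using (_≡_)
open import Relation.Binary.Construct.Composition using (_;_)
open import Relation.Binary.Construct.Closure.ReflexiveTransitive using (Star)

private
  variable
    a ℓ : Level
    Atom : Set a

module K* where

  infix  8 ¬_ □_ □*_
  infixr 7 _∧_
  infixr 6 _∨_

  data Formula (Atom : Set a) : Set a where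
    var     : Atom → Formula Atom
    ¬_      : Formula Atom → Formula Atom
    _∧_ _∨_ : Formula Atom → Formula Atom → Formula Atom
    □_ □*_  : Formula Atom → Formula Atom

  -- The finite set of subformulas, listed possibly with repetitions.
  subformulas : Formula Atom → List⁺ (Formula Atom)
  subformulas φ@(var _) = φ ∷ []
  subformulas φ@(¬ ψ)   = φ ∷ toList (subformulas ψ)
  subformulas φ@(ψ ∧ χ) = φ ∷ toList (subformulas ψ) ++ toList (subformulas χ)
  subformulas φ@(ψ ∨ χ) = φ ∷ toList (subformulas ψ) ++ toList (subformulas χ)
  subformulas φ@(□ ψ)   = φ ∷ toList (subformulas ψ)
  subformulas φ@(□* ψ)  = φ ∷ toList (subformulas ψ)

  record Model (Atom : Set a) (ℓ : Level) : Set (a ⊔ suc ℓ) where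
    field
      W   : Set ℓ
      R   : Rel W ℓ
      ‖_‖ : Atom → Pred W ℓ

  -- Classical when excluded middle holds for Set ℓ.
  infix 4 _,_⊩_
  _,_⊩_ : (M : Model Atom ℓ) → Model.W M → Formula Atom → Set ℓ
  M , w ⊩ var p = w ∈ Model.‖_‖ M p
  M , w ⊩ ¬ φ   = Not (M , w ⊩ φ)
  M , w ⊩ φ ∧ ψ = (M , w ⊩ φ) × (M , w ⊩ ψ)
  M , w ⊩ φ ∨ ψ = (M , w ⊩ φ) ⊎ (M , w ⊩ ψ)
  M , w ⊩ □ φ   = ∀ v → Model.R M w v → M , v ⊩ φ
  M , w ⊩ □* φ  = ∀ v → Star (Model.R M) w v → M , v ⊩ φ

  Valid : (ℓ : Level) {Atom : Set a} → Formula Atom → Set (a ⊔ suc ℓ)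
  Valid ℓ {Atom} φ = (M : Model Atom ℓ) (w : Model.W M) → M , w ⊩ φ

module CK where

  infix  8 ¬_ □_ □*_
  infixr 7 _∧_
  infixr 6 _∨_
  infixr 5 _⇒_

  data Formula (Atom : Set a) : Set a where
    ⊥           : Formula Atom
    var         : Atom → Formula Atom
    _∧_ _∨_ _⇒_ : Formula Atom → Formula Atom → Formula Atom
    □_ □*_      : Formula Atom → Formula Atom

  ¬_ : Formula Atom → Formula Atom
  ¬ φ = φ ⇒ ⊥

  ⋀ : List⁺ (Formula Atom) → Formula Atom
  ⋀ = foldr₁ _∧_

  -- ‖⊥‖, the set of fallible worlds, need not be empty.
  record Model (Atom : Set a) (ℓ : Level) : Set (a ⊔ suc ℓ) where
    infix 4 _≼_
    field
      W            : Set ℓ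
      _≼_          : Rel W ℓ
      ≼-isPreorder : IsPreorder _≡_ _≼_
      R            : Rel W ℓ
      ‖_‖          : Atom → Pred W ℓ
      ‖⊥‖          : Pred W ℓ
      ‖⊥‖⊆‖‖       : ∀ p → ‖⊥‖ ⊆ ‖ p ‖
      ‖‖-mono      : ∀ p {w v} → w ≼ v → w ∈ ‖ p ‖ → v ∈ ‖ p ‖
      ‖⊥‖-closed   : ∀ {w v} → w ∈ ‖⊥‖ → w ≼ v ⊎ R w v → v ∈ ‖⊥‖
      ‖⊥‖-serial   : ∀ {w} → w ∈ ‖⊥‖ → ∃ λ v → R w v

  -- _;_ (U+037E, not a semicolon) is relational composition.
  infix 4 _,_⊩_
  _,_⊩_ : (M : Model Atom ℓ) → Model.W M → Formula Atom → Set ℓ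
  M , w ⊩ ⊥     = w ∈ Model.‖⊥‖ M
  M , w ⊩ var p = w ∈ Model.‖_‖ M p
  M , w ⊩ φ ∧ ψ = (M , w ⊩ φ) × (M , w ⊩ ψ)
  M , w ⊩ φ ∨ ψ = (M , w ⊩ φ) ⊎ (M , w ⊩ ψ)
  M , w ⊩ φ ⇒ ψ = ∀ v → Model._≼_ M w v → M , v ⊩ φ → M , v ⊩ ψ
  M , w ⊩ □ φ   = ∀ v → (Model._≼_ M ; Model.R M) w v → M , v ⊩ φ
  M , w ⊩ □* φ  = ∀ v → Star (Model._≼_ M ; Model.R M) w v → M , v ⊩ φ

  Valid : (ℓ : Level) {Atom : Set a} → Formula Atom → Set (a ⊔ suc ℓ)
  Valid ℓ {Atom} φ = (M : Model Atom ℓ) (w : Model.W M) → M , w ⊩ φ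

⌜_⌝ : K*.Formula Atom → CK.Formula Atom
⌜ K*.var p ⌝ = CK.var p
⌜ K*.¬ φ ⌝   = CK.¬ ⌜ φ ⌝
⌜ φ K*.∧ ψ ⌝ = ⌜ φ ⌝ CK.∧ ⌜ ψ ⌝
⌜ φ K*.∨ ψ ⌝ = ⌜ φ ⌝ CK.∨ ⌜ ψ ⌝
⌜ K*.□ φ ⌝   = CK.□ ⌜ φ ⌝
⌜ K*.□* φ ⌝  = CK.□* ⌜ φ ⌝

ι : K*.Formula Atom → CK.Formula Atom
ι φ = □* ⋀ (map (λ ψ → ⌜ ψ ⌝ ∨ ¬ ⌜ ψ ⌝) (K*.subformulas φ)) ⇒ ⌜ φ ⌝
  where open CK

{-# OPTIONS --safe #-}

-- A K*-model is a CK-model whose order is equality and which has no fallible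
-- worlds; excluded middle makes the premise of ι φ hold there.  Conversely, a
-- fallible world of a CK-model satisfies every formula, and the infallible
-- worlds of a CK-model form a K*-model under ≼ ; R.  At an infallible world
-- whose ≼ ; R-reachable worlds decide all subformulas of φ, the two notions of
-- truth agree on φ.
module Submission where

open import Defs
open import Level using (Level; Lift; lift; lower)
open import Axiom.ExcludedMiddle using (ExcludedMiddle)
open import Data.Empty as Empty using (⊥-elim)
open import Data.List.Base using ([]; _∷_)
open import Data.List.NonEmpty as List⁺ using (_∷_; toList)
open import Data.List.Relation.Unary.All as All using (All; []; _∷_)
open import Data.List.Relation.Unary.All.Properties using (map⁺; map⁻; ++⁻ˡ; ++⁻ʳ)
open import Data.Product.Base using (_×_; _,_; proj₁)
open import Data.Product.Function.NonDependent.Propositional using (_×-⇔_)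
open import Data.Sum.Base using (inj₁; inj₂)
open import Data.Sum.Function.Propositional using (_⊎-⇔_)
open import Function.Base using (_∘_)
open import Function.Bundles using (_⇔_; mk⇔; Equivalence)
open import Function.Construct.Identity using (⇔-id)
open import Relation.Binary.Construct.Closure.ReflexiveTransitive as Star using (Star; ε; _◅_; _◅◅_)
open import Relation.Binary.Construct.Composition using (_;_)
open import Relation.Binary.Core using (Rel; _⇒_)
open import Relation.Binary.PropositionalEquality.Core using (_≡_; refl)
open import Relation.Binary.PropositionalEquality.Properties using (isPreorder)
open import Relation.Binary.Structures using (IsPreorder)
open import Relation.Unary using (Pred)
open import Relation.Nullary using (yes; no) renaming (¬_ to Not_)

open Equivalence

private
  variable
    a ℓ : Level
    Atom : Set a

-- The split on `φ` is there to make `subformulas φ` reduce to a cons, whose head is `φ` itself.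
subformulas-head : ∀ {P : Pred (K*.Formula Atom) ℓ} φ → All P (toList (K*.subformulas φ)) → P φ
subformulas-head (K*.var _)  = All.head
subformulas-head (K*.¬ _)    = All.head
subformulas-head (_ K*.∧ _)  = All.head
subformulas-head (_ K*.∨ _)  = All.head
subformulas-head (K*.□ _)    = All.head
subformulas-head (K*.□* _)   = All.head

-- Definitionally the function that `ι` maps over the subformulas, so facts about it apply directly
-- to the premise of `ι φ`.
excludedMiddle : K*.Formula Atom → CK.Formula Atom
excludedMiddle ψ = ⌜ ψ ⌝ CK.∨ CK.¬ ⌜ ψ ⌝

module _ (M : CK.Model Atom ℓ) {w : CK.Model.W M} where
  open CK using (_,_⊩_; ⋀)

  ⊩-⋀ : ∀ xs → (M , w ⊩ ⋀ xs) ⇔ All (M , w ⊩_) (toList xs)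
  ⊩-⋀ (x ∷ xs) = mk⇔ (split x xs) (join x xs)
    where
    split : ∀ x xs → M , w ⊩ ⋀ (x ∷ xs) → All (M , w ⊩_) (x ∷ xs)
    split x []       h       = h ∷ []
    split x (y ∷ ys) (h , t) = h ∷ split y ys t

    join : ∀ x xs → All (M , w ⊩_) (x ∷ xs) → M , w ⊩ ⋀ (x ∷ xs)
    join x []       (h ∷ []) = h
    join x (y ∷ ys) (h ∷ t)  = h , join y ys t

  Decides : K*.Formula Atom → Set ℓ
  Decides ψ = M , w ⊩ excludedMiddle ψ

  ⊩-⋀-excludedMiddle : ∀ φs → (M , w ⊩ ⋀ (List⁺.map excludedMiddle φs)) ⇔ All Decides (toList φs)
  ⊩-⋀-excludedMiddle φs = mk⇔ (map⁻ ∘ to ⋀⇔All) (from ⋀⇔All ∘ map⁺)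
    where ⋀⇔All = ⊩-⋀ (List⁺.map excludedMiddle φs)

module Classical (M : K*.Model Atom ℓ) where
  open K*.Model M

  discrete : CK.Model Atom ℓ
  discrete = record
    { W            = W
    ; _≼_          = _≡_
    ; ≼-isPreorder = isPreorder
    ; R            = R
    ; ‖_‖          = ‖_‖
    ; ‖⊥‖          = λ _ → Lift _ Empty.⊥
    ; ‖⊥‖⊆‖‖       = λ _ ()
    ; ‖‖-mono      = λ { _ refl h → h }
    ; ‖⊥‖-closed   = λ ()
    ; ‖⊥‖-serial   = λ ()
    }

  unstep : (_≡_ ; R) ⇒ R
  unstep (_ , refl , r) = r

  step : R ⇒ (_≡_ ; R)
  step r = _ , refl , r

  -- Under equality an implication inspects only `w`, and `_≡_ ; R` relates the same worlds as `R`,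
  -- hence so do the closures.
  discrete-⊩ : ∀ φ {w} → (discrete CK., w ⊩ ⌜ φ ⌝) ⇔ (M K*., w ⊩ φ)
  discrete-⊩ (K*.var p) = ⇔-id _
  discrete-⊩ (K*.¬ φ)   = mk⇔
    (λ h k → lower (h _ refl (from (discrete-⊩ φ) k)))
    (λ { h _ refl k → lift (h (to (discrete-⊩ φ) k)) })
  discrete-⊩ (φ K*.∧ ψ) = discrete-⊩ φ ×-⇔ discrete-⊩ ψ
  discrete-⊩ (φ K*.∨ ψ) = discrete-⊩ φ ⊎-⇔ discrete-⊩ ψ
  discrete-⊩ (K*.□ φ)   = mk⇔
    (λ h v r → to (discrete-⊩ φ) (h v (step r)))
    (λ h v r → from (discrete-⊩ φ) (h v (unstep r)))
  discrete-⊩ (K*.□* φ)  = mk⇔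
    (λ h v r → to (discrete-⊩ φ) (h v (Star.map step r)))
    (λ h v r → from (discrete-⊩ φ) (h v (Star.map unstep r)))

  discrete-decides : ExcludedMiddle ℓ → ∀ {w} ψ → Decides discrete {w} ψ
  discrete-decides em {w} ψ with em {discrete CK., w ⊩ ⌜ ψ ⌝}
  ... | yes h = inj₁ h
  ... | no ¬h = inj₂ λ { _ refl h → lift (¬h h) }

module Constructive (M : CK.Model Atom ℓ) where
  open CK.Model M
  open CK using (_,_⊩_)

  infix 4 _⟶_ _⟶*_

  _⟶_ _⟶*_ : Rel W ℓ
  _⟶_  = _≼_ ; R
  _⟶*_ = Star _⟶_

  ‖⊥‖-⟶ : ∀ {w v} → w ⟶ v → ‖⊥‖ w → ‖⊥‖ v
  ‖⊥‖-⟶ (_ , w≼u , uRv) b = ‖⊥‖-closed (‖⊥‖-closed b (inj₁ w≼u)) (inj₂ uRv)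

  ‖⊥‖-⟶* : ∀ {w v} → w ⟶* v → ‖⊥‖ w → ‖⊥‖ v
  ‖⊥‖-⟶* ε        b = b
  ‖⊥‖-⟶* (r ◅ rs) b = ‖⊥‖-⟶* rs (‖⊥‖-⟶ r b)

  -- In the cases of `⇒`, `□` and `□*`, every world inspected from a fallible one is again fallible,
  -- so the induction goes through.
  explosion : ∀ φ {w} → ‖⊥‖ w → M , w ⊩ φ
  explosion CK.⊥         b = b
  explosion (CK.var p)   b = ‖⊥‖⊆‖‖ p b
  explosion (φ CK.∧ ψ)   b = explosion φ b , explosion ψ b
  explosion (φ CK.∨ ψ)   b = inj₁ (explosion φ b)
  explosion (φ CK.⇒ ψ)   b = λ _ w≼v _ → explosion ψ (‖⊥‖-closed b (inj₁ w≼v))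
  explosion (CK.□ φ)     b = λ _ r → explosion φ (‖⊥‖-⟶ r b)
  explosion (CK.□* φ)    b = λ _ r → explosion φ (‖⊥‖-⟶* r b)

  infix 4 _⟶ᵢ_

  -- Constraining the target is enough: by `‖⊥‖-⟶` it forces the source to be infallible too.
  _⟶ᵢ_ : Rel W ℓ
  w ⟶ᵢ v = w ⟶ v × Not ‖⊥‖ v

  -- Fallible worlds stay, but become unreachable: pairing each world with a
  -- proof of its infallibility would, without function extensionality, create
  -- several copies of it, and then ε would not lift to Star.
  infallible : K*.Model Atom ℓ
  infallible = record { W = W ; R = _⟶ᵢ_ ; ‖_‖ = ‖_‖ }

  ⟶ᵢ*-infallible : ∀ {w v} → Star _⟶ᵢ_ w v → Not ‖⊥‖ w → Not ‖⊥‖ v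
  ⟶ᵢ*-infallible ε              ¬w = ¬w
  ⟶ᵢ*-infallible ((_ , ¬u) ◅ r) _  = ⟶ᵢ*-infallible r ¬u

  -- Fallibility propagates forward, so an infallible endpoint makes the whole path infallible.
  ⟶*⇒⟶ᵢ* : ∀ {w v} → w ⟶* v → Not ‖⊥‖ v → Star _⟶ᵢ_ w v
  ⟶*⇒⟶ᵢ* ε        ¬v = ε
  ⟶*⇒⟶ᵢ* (r ◅ rs) ¬v = (r , ¬v ∘ ‖⊥‖-⟶* rs) ◅ ⟶*⇒⟶ᵢ* rs ¬v

  -- The content of the premise of `ι φ` at `w`. Ranging over all reachable worlds, it is inherited
  -- along `_⟶_` and `_⟶*_`, as the modal cases require.
  DecidesSubformulas : K*.Formula Atom → W → Set _
  DecidesSubformulas φ w =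
    ∀ v → w ⟶* v → All (λ ψ → Decides M {v} ψ) (toList (K*.subformulas φ))

  module _ (em : ExcludedMiddle ℓ) where

    unless-fallible : ∀ φ {w} → (Not ‖⊥‖ w → M , w ⊩ φ) → M , w ⊩ φ
    unless-fallible φ {w} h with em {‖⊥‖ w}
    ... | yes b = explosion φ b
    ... | no ¬b = h ¬b

    infallible-⊩ : ∀ φ {w} → DecidesSubformulas φ w → Not ‖⊥‖ w →
                   (M , w ⊩ ⌜ φ ⌝) ⇔ (infallible K*., w ⊩ φ)
    infallible-⊩ (K*.var p) d ¬w = ⇔-id _
    infallible-⊩ (K*.¬ φ) {w} d ¬w = mk⇔
      (λ h k → ¬w (h w ≼-refl (from ih k)))
      (λ h → refute h (subformulas-head φ (All.tail (d w ε))))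
      where
      ≼-refl = IsPreorder.refl ≼-isPreorder
      ih = infallible-⊩ φ (λ v r → All.tail (d v r)) ¬w
      -- Failure of `φ` at `w` says nothing about the other `≼`-successors of `w`; the decision at
      -- `w` bridges this gap, since its right disjunct already covers them all.
      refute : Not (infallible K*., w ⊩ φ) → Decides M {w} φ → M , w ⊩ CK.¬ ⌜ φ ⌝
      refute h (inj₁ k) = ⊥-elim (h (to ih k))
      refute h (inj₂ k) = k
    infallible-⊩ (φ K*.∧ ψ) d ¬w =
      infallible-⊩ φ (λ v r → ++⁻ˡ _ (All.tail (d v r))) ¬w ×-⇔
      infallible-⊩ ψ (λ v r → ++⁻ʳ (toList (K*.subformulas φ)) (All.tail (d v r))) ¬w
    infallible-⊩ (φ K*.∨ ψ) d ¬w =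
      infallible-⊩ φ (λ v r → ++⁻ˡ _ (All.tail (d v r))) ¬w ⊎-⇔
      infallible-⊩ ψ (λ v r → ++⁻ʳ (toList (K*.subformulas φ)) (All.tail (d v r))) ¬w
    infallible-⊩ (K*.□ φ) {w} d ¬w = mk⇔
      (λ { h v (r , ¬v) → to (ih r ¬v) (h v r) })
      -- The constructive box also visits fallible successors, where `⌜ φ ⌝` holds by `explosion`;
      -- the others are `_⟶ᵢ_`-successors.
      (λ h v r → unless-fallible ⌜ φ ⌝ λ ¬v → from (ih r ¬v) (h v (r , ¬v)))
      where
      ih : ∀ {v} → w ⟶ v → Not ‖⊥‖ v → (M , v ⊩ ⌜ φ ⌝) ⇔ (infallible K*., v ⊩ φ)
      ih r = infallible-⊩ φ (λ u s → All.tail (d u (r ◅ s)))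
    infallible-⊩ (K*.□* φ) {w} d ¬w = mk⇔
      (λ h v r → to (ih (Star.map proj₁ r) (⟶ᵢ*-infallible r ¬w)) (h v (Star.map proj₁ r)))
      (λ h v r → unless-fallible ⌜ φ ⌝ λ ¬v → from (ih r ¬v) (h v (⟶*⇒⟶ᵢ* r ¬v)))
      where
      ih : ∀ {v} → w ⟶* v → Not ‖⊥‖ v → (M , v ⊩ ⌜ φ ⌝) ⇔ (infallible K*., v ⊩ φ)
      ih r = infallible-⊩ φ (λ u s → All.tail (d u (r ◅◅ s)))

theorem6p5 : {a ℓ : Level} → ExcludedMiddle ℓ → {Atom : Set a} (φ : K*.Formula Atom) → K*.Valid ℓ φ ⇔ CK.Valid ℓ (ι φ)
theorem6p5 {ℓ = ℓ} em φ = mk⇔ K*⇒CK CK⇒K*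
  where
  φs = K*.subformulas φ

  K*⇒CK : K*.Valid ℓ φ → CK.Valid ℓ (ι φ)
  K*⇒CK valid M _ w _ h = unless-fallible em ⌜ φ ⌝ λ ¬w →
    from (infallible-⊩ em φ (λ v r → to (⊩-⋀-excludedMiddle M φs) (h v r)) ¬w) (valid infallible w)
    where
    open Constructive M

  CK⇒K* : CK.Valid ℓ (ι φ) → K*.Valid ℓ φ
  CK⇒K* valid M w = to (discrete-⊩ φ)
    -- The implication `ι φ` is used at `w` itself; its premise holds because excluded middle
    -- decides every formula at every world.
    (valid discrete w w refl λ v _ →
      from (⊩-⋀-excludedMiddle discrete φs) (All.universal (discrete-decides em) _))
    where
    open Classical M
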